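{- Kleene–Vesley realizability (the topos $\mathbf{RT}(\mathcal{K}_2^{\mathrm{rec}}, \mathcal{K}_2)$) does not validate the statement "$\mathbb{N}_\infty$ has the Myhill property".
   Context: $\mathcal{K}_2$ is Kleene's second algebra, the partial combinatory algebra on $\mathbb{N}^{\mathbb{N}}$ in which $e \cdot q$ is the result of applying the partial continuous function $\mathbb{N}^\mathbb{N} \rightharpoonup \mathbb{N}^\mathbb{N}$ coded by $e$ to $q$; $\mathcal{K}_2^{\mathrm{rec}}$ is its sub-algebra of computable sequences. The Kleene–Vesley topos $\mathbf{RT}(\mathcal{K}_2^{\mathrm{rec}}, \mathcal{K}_2)$ is the relative realizability topos in which realizers range over $\mathcal{K}_2$ and a statement is valid iff it has a realizer in $\mathcal{K}_2^{\mathrm{rec}}$. The metatheory is classical. The following definitions are interpreted in the internal logic. $\mathbb{N}_\infty \subseteq 2^{\mathbb{N}}$ is the set of bit sequences containing at most one $1$. A set $X$ has the Myhill property if for all subsets $A, B \subseteq X$: if there are injections $f, g : X \to X$ with $A = f^{ -1}(B)$ and $B = g^{ -1}(A)$, then there is a bijection $h : X \to X$ which restricts to a bijection between $A$ and $B$. -}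

module Defs where

open import Data.Fin using (Fin; zero; suc; toℕ)
open import Data.List using (List; []; _∷_; applyUpTo)
open import Data.Nat using (ℕ; zero; suc; _+_; _*_; _^_; _<_)
open import Data.Product using (Σ; Σ-syntax; ∃-syntax; _×_; _,_; proj₁; proj₂)
open import Data.Vec as Vec using (Vec; lookup)
open import Data.Vec.Relation.Binary.Pointwise.Inductive using (Pointwise)
open import Function using (_∘_; id)
open import Level using (Level; _⊔_; 0ℓ) renaming (suc to lsuc)
open import Relation.Binary.PropositionalEquality
  using (_≡_; _≗_; refl; sym; trans)

private
  variable
    a b ℓ ℓ₁ ℓ₂ ℓ₃ : Level
    m n : ℕ

------------------------------------------------------------------------
-- Computable sequences, via μ-recursive functions

data Rec : ℕ → Set where
  zer  : Rec 0
  succ : Rec 1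
  proj : Fin n → Rec n
  comp : Rec m → Vec (Rec n) m → Rec n
  prec : Rec n → Rec (2 + n) → Rec (suc n)
  mu   : Rec (suc n) → Rec n

infix 4 _[_]⇓_

data _[_]⇓_ : Rec n → Vec ℕ n → ℕ → Set where
  zer    : zer [ Vec.[] ]⇓ 0
  succ   : ∀ {x} → succ [ Vec.[ x ] ]⇓ suc x
  proj   : ∀ {xs : Vec ℕ n} i → proj i [ xs ]⇓ lookup xs i
  comp   : ∀ {f : Rec m} {gs : Vec (Rec n) m} {xs ys z} →
           Pointwise (λ g y → g [ xs ]⇓ y) gs ys →
           f [ ys ]⇓ z →
           comp f gs [ xs ]⇓ z
  prec-z : ∀ {f : Rec n} {g xs y} →
           f [ xs ]⇓ y →
           prec f g [ 0 Vec.∷ xs ]⇓ y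
  prec-s : ∀ {f : Rec n} {g xs k y z} →
           prec f g [ k Vec.∷ xs ]⇓ y →
           g [ k Vec.∷ y Vec.∷ xs ]⇓ z →
           prec f g [ suc k Vec.∷ xs ]⇓ z
  mu     : ∀ {f : Rec (suc n)} {xs k} →
           f [ k Vec.∷ xs ]⇓ 0 →
           (∀ j → j < k → ∃[ y ] f [ j Vec.∷ xs ]⇓ suc y) →
           mu f [ xs ]⇓ k

------------------------------------------------------------------------
-- Kleene's second algebra

𝒦₂ : Set
𝒦₂ = ℕ → ℕ

Computable : 𝒦₂ → Set
Computable e = Σ[ c ∈ Rec 1 ] (∀ n → c [ Vec.[ n ] ]⇓ e n)

-- A bijection between finite sequences and numbers.
code : List ℕ → ℕ
code []       = 0
code (x ∷ xs) = 2 ^ x * (1 + 2 * code xs)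

infix 4 _·_↦_

-- e · q is defined with value r.  To compute r n, feed e with n followed by
-- longer and longer prefixes of q: the answer 0 means "more input needed",
-- and the first other answer is 1 + r n.
_·_↦_ : 𝒦₂ → 𝒦₂ → 𝒦₂ → Set
e · q ↦ r = ∀ n → ∃[ k ]
  (e (code (n ∷ applyUpTo q k)) ≡ suc (r n) ×
   (∀ j → j < k → e (code (n ∷ applyUpTo q j)) ≡ 0))

-- Every p is the pair of its even part and its odd part.
fst snd : 𝒦₂ → 𝒦₂
fst p n = p (2 * n)
snd p n = p (1 + 2 * n)

------------------------------------------------------------------------
-- Truth values: sets of realizers

-- Sequences are considered up to pointwise equality.
record Truth ℓ : Set (lsuc ℓ) where
  field
    _∋_  : 𝒦₂ → Set ℓ
    resp : ∀ {p q} → p ≗ q → _∋_ p → _∋_ q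

open Truth public

-- The power set of 𝒦₂.  Quantifying over it (or over large carriers) yields a
-- Truth (lsuc 0ℓ); under excluded middle each of these is logically equivalent
-- to an element of Ω, so that restricting subsets to be Ω-valued loses nothing.
Ω : Set₁
Ω = Truth 0ℓ

infixr 4 _∧_
infixr 3 _⇒_
infix  2 _⇔_

_∧_ : Truth ℓ₁ → Truth ℓ₂ → Truth (ℓ₁ ⊔ ℓ₂)
(φ ∧ ψ) ∋ p          = φ ∋ fst p × ψ ∋ snd p
(φ ∧ ψ) .resp eq (x , y) =
  φ .resp (λ n → eq (2 * n)) x , ψ .resp (λ n → eq (1 + 2 * n)) y

_⇒_ : Truth ℓ₁ → Truth ℓ₂ → Truth (ℓ₁ ⊔ ℓ₂)
(φ ⇒ ψ) ∋ e = ∀ q → φ ∋ q → Σ[ r ∈ 𝒦₂ ] (e · q ↦ r × ψ ∋ r)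
(φ ⇒ ψ) .resp eq h q x =
  let r , app , y = h q x in
  r
  , (λ n → let k , halt , wait = app n in
       k , trans (sym (eq _)) halt
         , λ j j<k → trans (sym (eq _)) (wait j j<k))
  , y

_⇔_ : Truth ℓ₁ → Truth ℓ₂ → Truth (ℓ₁ ⊔ ℓ₂)
φ ⇔ ψ = (φ ⇒ ψ) ∧ (ψ ⇒ φ)

⋀ : {A : Set a} → (A → Truth ℓ) → Truth (a ⊔ ℓ)
⋀ φ ∋ p            = ∀ x → φ x ∋ p
⋀ φ .resp eq h x   = φ x .resp eq (h x)

⋁ : {A : Set a} → (A → Truth ℓ) → Truth (a ⊔ ℓ)
⋁ {A = A} φ ∋ p        = Σ[ x ∈ A ] φ x ∋ p
⋁ φ .resp eq (x , h)   = x , φ x .resp eq h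

-- Relative realizability: realizers range over 𝒦₂, validity requires a
-- computable one.
Valid : Truth ℓ → Set ℓ
Valid φ = Σ[ e ∈ 𝒦₂ ] (Computable e × φ ∋ e)

------------------------------------------------------------------------
-- Objects of the topos and its internal logic

-- A set with a truth-valued equality.  In the topos the equality is moreover
-- validly symmetric and transitive; this holds of all the objects constructed
-- below, and is not needed to interpret formulas.
record Obj a ℓ : Set (lsuc (a ⊔ ℓ)) where
  field
    Carrier : Set a
    eq      : Carrier → Carrier → Truth ℓ

open Obj public

infix 5 equal
equal : (X : Obj a ℓ) → Carrier X → Carrier X → Truth ℓ
equal = eq

syntax equal X x y = x ≈[ X ] y

-- Existence predicate.
E : (X : Obj a ℓ) → Carrier X → Truth ℓ
E X x = x ≈[ X ] x

infix 2 Forall Exists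

Forall : (X : Obj a ℓ₁) → (Carrier X → Truth ℓ₂) → Truth (a ⊔ ℓ₁ ⊔ ℓ₂)
Forall X φ = ⋀ λ x → E X x ⇒ φ x

Exists : (X : Obj a ℓ₁) → (Carrier X → Truth ℓ₂) → Truth (a ⊔ ℓ₁ ⊔ ℓ₂)
Exists X φ = ⋁ λ x → E X x ∧ φ x

syntax Forall X (λ x → φ) = ∀[ x ∈ X ] φ
syntax Exists X (λ x → φ) = ∃[ x ∈ X ] φ

-- Discrete objects: x is realized by the sequences whose head is ι x.
discrete : (A : Set) → (A → ℕ) → Obj 0ℓ 0ℓ
discrete A ι .Carrier           = A
discrete A ι .eq x y ∋ p        = x ≡ y × p 0 ≡ ι x
discrete A ι .eq x y .resp p≗q (x≡y , h) = x≡y , trans (sym (p≗q 0)) h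

𝐍 𝟐 : Obj 0ℓ 0ℓ
𝐍 = discrete ℕ id
𝟐 = discrete (Fin 2) toℕ

-- Power object: strict extensional predicates.
𝒫 : Obj a ℓ → Obj (lsuc 0ℓ ⊔ a) (a ⊔ ℓ)
𝒫 X .Carrier = Carrier X → Ω
𝒫 X .eq A B =
    (⋀ λ x → A x ⇒ E X x)
  ∧ (⋀ λ x → ⋀ λ y → A x ∧ x ≈[ X ] y ⇒ A y)
  ∧ (⋀ λ x → A x ⇔ B x)

-- Exponential: functional relations (strict, extensional, single-valued, total).
infixr 6 _⟶_
_⟶_ : Obj a ℓ₁ → Obj b ℓ₂ → Obj (lsuc 0ℓ ⊔ a ⊔ b) (a ⊔ b ⊔ ℓ₁ ⊔ ℓ₂)
(X ⟶ Y) .Carrier = Carrier X → Carrier Y → Ω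
(X ⟶ Y) .eq F G =
    (⋀ λ x → ⋀ λ y → F x y ⇒ E X x ∧ E Y y)
  ∧ (⋀ λ x → ⋀ λ x′ → ⋀ λ y → ⋀ λ y′ →
       F x y ∧ x ≈[ X ] x′ ∧ y ≈[ Y ] y′ ⇒ F x′ y′)
  ∧ (⋀ λ x → ⋀ λ y → ⋀ λ y′ → F x y ∧ F x y′ ⇒ y ≈[ Y ] y′)
  ∧ (⋀ λ x → E X x ⇒ ⋁ λ y → F x y)
  ∧ (⋀ λ x → ⋀ λ y → F x y ⇔ G x y)

-- Subobject cut out by a formula.
Sub : (X : Obj a ℓ₁) → (Carrier X → Truth ℓ₂) → Obj a (ℓ₁ ⊔ ℓ₂)
Sub X φ .Carrier  = Carrier X
Sub X φ .eq x y   = x ≈[ X ] y ∧ φ x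

syntax Sub X (λ x → φ) = ⟪ x ∈ X ∣ φ ⟫

-- Below, F x y expresses "F(x) = y" for a function F.

𝐍∞ : Obj (lsuc 0ℓ) 0ℓ
𝐍∞ = ⟪ α ∈ 𝐍 ⟶ 𝟐 ∣
        (∀[ i ∈ 𝐍 ] ∀[ j ∈ 𝐍 ] α i (suc zero) ∧ α j (suc zero) ⇒ i ≈[ 𝐍 ] j) ⟫

------------------------------------------------------------------------
-- The Myhill property

module _ (X : Obj a ℓ) where

  Injective : Carrier (X ⟶ X) → Truth (a ⊔ ℓ)
  Injective F =
    ∀[ x ∈ X ] ∀[ x′ ∈ X ] ∀[ y ∈ X ] F x y ∧ F x′ y ⇒ x ≈[ X ] x′

  Surjective : Carrier (X ⟶ X) → Truth (a ⊔ ℓ)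
  Surjective F = ∀[ y ∈ X ] ∃[ x ∈ X ] F x y

  Bijective : Carrier (X ⟶ X) → Truth (a ⊔ ℓ)
  Bijective F = Injective F ∧ Surjective F

  -- A = F⁻¹(B)
  IsPreimage : Carrier (X ⟶ X) → Carrier (𝒫 X) → Carrier (𝒫 X) → Truth (a ⊔ ℓ)
  IsPreimage F A B = ∀[ x ∈ X ] (A x ⇔ (∃[ y ∈ X ] F x y ∧ B y))

  -- F maps A into B, and onto B; when F is injective, so is its restriction.
  RestrictsToBijection :
    Carrier (X ⟶ X) → Carrier (𝒫 X) → Carrier (𝒫 X) → Truth (a ⊔ ℓ)
  RestrictsToBijection F A B =
      (∀[ x ∈ X ] (A x ⇒ (∃[ y ∈ X ] F x y ∧ B y)))
    ∧ (∀[ y ∈ X ] (B y ⇒ (∃[ x ∈ X ] A x ∧ F x y)))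

  MyhillProperty : Truth (lsuc 0ℓ ⊔ a ⊔ ℓ)
  MyhillProperty =
    ∀[ A ∈ 𝒫 X ] ∀[ B ∈ 𝒫 X ]
      ((∃[ f ∈ X ⟶ X ] ∃[ g ∈ X ⟶ X ]
          Injective f ∧ Injective g ∧ IsPreimage f A B ∧ IsPreimage g B A)
       ⇒ (∃[ h ∈ X ⟶ X ] Bijective h ∧ RestrictsToBijection h A B))

{-# OPTIONS --safe #-}
module Submission where

-- Let f = g be the injection n ↦ 2n + 1, ∞ ↦ ∞, and let a realizer of x ∈ A or
-- x ∈ B be a realizer of x together with a number, a "label", such that both
-- f and g increase labels by one.  Any family of label sets compatible with this
-- shift gives subsets A, B with A = f⁻¹(B) and B = g⁻¹(A), and the realizers of
-- these facts do not depend on the family.  So a realizer of the Myhill property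
-- answers with realizers independent of the family, in particular with continuous
-- maps φ and ψ sending the labels of x ∈ A to labels of h(x) ∈ B, and the labels
-- of y ∈ B to labels of h⁻¹(y) ∈ A.  Let φ send the label 0 of ∞ to j, and ψ send
-- the label j of ∞ to i; by continuity the same happens at all large enough n.
--
-- * If all labels are generated by the label 0 of a large even n ∈ A, then h(n)
--   has label j, so it is a large number, and h⁻¹(h(n)) = n has label i.  As n is
--   not in the image of g, its only label is 0, so i = 0.
-- * If all labels are generated by the label j of a large even n ∈ B, then h⁻¹(n)
--   has label i.  As every label in A exceeds j, i ≠ 0.
--
-- Excluded middle makes every partial continuous map representable in 𝒦₂, and
-- makes every element of ℕ∞ a number or ∞.

open import Defs
open import Axiom.ExcludedMiddle using (ExcludedMiddle)
open import Data.Bool using (Bool; true; false; not)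
open import Data.Bool.Properties using (not-injective)
open import Data.Empty using (⊥; ⊥-elim)
open import Data.Fin using (Fin; zero; suc; toℕ)
open import Data.List using (List; []; _∷_; applyUpTo; length)
open import Data.List.Properties using (length-applyUpTo; ∷-injectiveˡ; ∷-injectiveʳ)
open import Data.Maybe using (Maybe; just; nothing) renaming (map to mapMaybe)
open import Data.Maybe.Properties using (just-injective)
open import Data.Nat
  using (ℕ; zero; suc; pred; _+_; _*_; _^_; _⊔_; _≤_; _<_; _≟_; z≤n; s≤s; z<s; s<s)
open import Data.Nat.Properties
open import Data.Product using (Σ-syntax; ∃-syntax; _×_; _,_; proj₁; proj₂)
open import Data.Sum using (_⊎_; inj₁; inj₂)
open import Data.Unit using (⊤; tt)
open import Function using (_∘_; id; case_of_)
open import Level using (Level; 0ℓ; Lift; lift; lower) renaming (suc to lsuc)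
open import Relation.Binary.Definitions using (tri<; tri≈; tri>)
open import Relation.Binary.PropositionalEquality
  using (_≡_; _≢_; _≗_; refl; sym; trans; cong; cong₂; subst)
open import Relation.Nullary using (¬_; Dec; yes; no)
open import Relation.Nullary.Decidable using (map′)

private
  variable
    ℓ ℓ₁ ℓ₂ : Level
    d e p q r s : 𝒦₂

-- Injectivity of the coding of finite sequences

2^*odd-zero : ∀ x {m n} → 2 ^ suc x * suc (2 * m) ≢ 2 ^ 0 * suc (2 * n)
2^*odd-zero x {m} {n} eq = even≢odd (2 ^ x * suc (2 * m)) n
  (trans (sym (*-assoc 2 (2 ^ x) (suc (2 * m)))) (trans eq (*-identityˡ (suc (2 * n)))))

2^*odd-injective : ∀ x y {m n} → 2 ^ x * suc (2 * m) ≡ 2 ^ y * suc (2 * n) → x ≡ y × m ≡ n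
2^*odd-injective zero zero {m} {n} eq =
  refl , *-cancelˡ-≡ m n 2 (suc-injective
    (trans (sym (*-identityˡ (suc (2 * m)))) (trans eq (*-identityˡ (suc (2 * n))))))
2^*odd-injective zero (suc y) {m} {n} eq = ⊥-elim (2^*odd-zero y {n} {m} (sym eq))
2^*odd-injective (suc x) zero {m} {n} eq = ⊥-elim (2^*odd-zero x {m} {n} eq)
2^*odd-injective (suc x) (suc y) {m} {n} eq =
  let x≡y , m≡n = 2^*odd-injective x y {m} {n} (*-cancelˡ-≡ _ _ 2
        (trans (sym (*-assoc 2 (2 ^ x) (suc (2 * m)))) (trans eq (*-assoc 2 (2 ^ y) (suc (2 * n))))))
  in cong suc x≡y , m≡n

code-∷≢0 : ∀ x l → code (x ∷ l) ≢ 0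
code-∷≢0 x l eq = n≮0 (subst (0 <_) eq (*-mono-< (m^n>0 2 x) (z<s {2 * code l})))

code-injective : ∀ k l → code k ≡ code l → k ≡ l
code-injective []      []      _  = refl
code-injective []      (y ∷ l) eq = ⊥-elim (code-∷≢0 y l (sym eq))
code-injective (x ∷ k) []      eq = ⊥-elim (code-∷≢0 x k eq)
code-injective (x ∷ k) (y ∷ l) eq =
  let x≡y , k≡l = 2^*odd-injective x y eq in cong₂ _∷_ x≡y (code-injective k l k≡l)

-- Prefixes and the continuity of application

infix 4 _≗[_]_
_≗[_]_ : 𝒦₂ → ℕ → 𝒦₂ → Set
p ≗[ k ] q = ∀ j → j < k → p j ≡ q j

≗[]-mono : ∀ {k l} → k ≤ l → p ≗[ l ] q → p ≗[ k ] q
≗[]-mono k≤l eq j j<k = eq j (<-≤-trans j<k k≤l)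

applyUpTo-cong : ∀ k → p ≗[ k ] q → applyUpTo p k ≡ applyUpTo q k
applyUpTo-cong zero    eq = refl
applyUpTo-cong (suc k) eq =
  cong₂ _∷_ (eq 0 z<s) (applyUpTo-cong k λ j j<k → eq (suc j) (s<s j<k))

applyUpTo-injective : ∀ k → applyUpTo p k ≡ applyUpTo q k → p ≗[ k ] q
applyUpTo-injective (suc k) eq zero    _         = ∷-injectiveˡ eq
applyUpTo-injective (suc k) eq (suc j) (s<s j<k) = applyUpTo-injective k (∷-injectiveʳ eq) j j<k

least-nonzero : ∀ (g : ℕ → ℕ) k {v} → g k ≡ suc v →
                ∃[ l ] ∃[ w ] (g l ≡ suc w × (∀ j → j < l → g j ≡ 0))
least-nonzero g zero    {v} eq = 0 , v , eq , λ _ ()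
least-nonzero g (suc k) eq with g 0 in g0
... | suc w = 0 , w , g0 , λ _ ()
... | zero with l , w , eq′ , below ← least-nonzero (g ∘ suc) k eq =
  suc l , w , eq′ , λ { zero _ → g0 ; (suc j) (s<s j<l) → below j j<l }

-- Bounds the indices at which a run on n and prefixes of q consults its code, so that continuity in
-- the code can be stated too.
maxCode : ℕ → 𝒦₂ → ℕ → ℕ
maxCode n q zero    = code (n ∷ [])
maxCode n q (suc k) = maxCode n q k ⊔ code (n ∷ applyUpTo q (suc k))

code≤maxCode : ∀ n q {j k} → j ≤ k → code (n ∷ applyUpTo q j) ≤ maxCode n q k
code≤maxCode n q {j} {zero}  z≤n = ≤-refl
code≤maxCode n q {j} {suc k} j≤1+k with m≤n⇒m<n∨m≡n j≤1+k
... | inj₁ (s≤s j≤k) = ≤-trans (code≤maxCode n q j≤k) (m≤m⊔n _ _)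
... | inj₂ refl = m≤n⊔m (maxCode n q k) _

-- If the stages differed, the answer at the earlier one would be both zero and nonzero; that stage
-- is at most k, where g and g′ agree.
halt-unique : ∀ {g g′ : ℕ → ℕ} {k k′ v v′} → (∀ j → j ≤ k → g j ≡ g′ j) →
              g k ≡ suc v → (∀ j → j < k → g j ≡ 0) →
              g′ k′ ≡ suc v′ → (∀ j → j < k′ → g′ j ≡ 0) → v ≡ v′
halt-unique {k = k} {k′} agree gk g< g′k′ g′< with <-cmp k k′
... | tri< k<k′ _ _ with () ← trans (sym gk) (trans (agree k ≤-refl) (g′< k k<k′))
... | tri≈ _ refl _ = suc-injective (trans (sym gk) (trans (agree k ≤-refl) g′k′))
... | tri> _ _ k′<k with () ← trans (sym g′k′) (trans (sym (agree k′ (<⇒≤ k′<k))) (g< k′ k′<k))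

-- A halting run reads finitely many entries of the code and of the argument. Continuity in both at
-- once yields determinism, and the continuity of q ↦ s · t when s and t depend on q.
app-continuous : d · q ↦ r → ∀ n → ∃[ k ] (∀ {d′ q′ r′} →
                 d ≗[ k ] d′ → q ≗[ k ] q′ → d′ · q′ ↦ r′ → r n ≡ r′ n)
app-continuous {d} {q} {r} app n = k ⊔ suc (maxCode n q k) , same
  where
  k = proj₁ (app n)
  same : ∀ {d′ q′ r′} → d ≗[ _ ] d′ → q ≗[ _ ] q′ → d′ · q′ ↦ r′ → r n ≡ r′ n
  same {d′} {q′} {r′} d≗d′ q≗q′ app′ =
    let _ , halt , wait = app n ; _ , halt′ , wait′ = app′ n in
    halt-unique
      (λ j j≤k → trans
        (d≗d′ _ (≤-trans (s≤s (code≤maxCode n q j≤k)) (m≤n⊔m k _)))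
        (cong (d′ ∘ code ∘ (n ∷_)) (applyUpTo-cong j (≗[]-mono (≤-trans j≤k (m≤m⊔n k _)) q≗q′))))
      halt wait halt′ wait′

↦-deterministic : d · q ↦ r → d · q ↦ s → r ≗ s
↦-deterministic {d} {q} {r} {s} x y n =
  app-continuous {d} {q} {r} x n .proj₂ {d} {q} {s} (λ _ _ → refl) (λ _ _ → refl) y

↦-resp : d ≗ e → q ≗ p → r ≗ s → d · q ↦ r → e · p ↦ s
↦-resp {d} {e} {q} {p} {r} {s} d≗e q≗p r≗s app n =
  let k , halt , wait = app n in
  k , trans (same k) (trans halt (cong suc (r≗s n))) , λ j j<k → trans (same j) (wait j j<k)
  where
  same : ∀ j → e (code (n ∷ applyUpTo p j)) ≡ d (code (n ∷ applyUpTo q j))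
  same j = trans (sym (d≗e _)) (cong (d ∘ code ∘ (n ∷_)) (applyUpTo-cong j λ i _ → sym (q≗p i)))

-- Pairing, and continuity of relations

const : ℕ → 𝒦₂
const n _ = n

⟨_,_⟩ : 𝒦₂ → 𝒦₂ → 𝒦₂
⟨ p , q ⟩ zero          = p 0
⟨ p , q ⟩ (suc zero)    = q 0
⟨ p , q ⟩ (suc (suc n)) = ⟨ p ∘ suc , q ∘ suc ⟩ n

fst-pair : ∀ p q → fst ⟨ p , q ⟩ ≗ p
fst-pair p q zero    = refl
fst-pair p q (suc n) = trans (cong ⟨ p , q ⟩ (*-suc 2 n)) (fst-pair (p ∘ suc) (q ∘ suc) n)

snd-pair : ∀ p q → snd ⟨ p , q ⟩ ≗ q
snd-pair p q zero    = refl
snd-pair p q (suc n) = trans (cong (⟨ p , q ⟩ ∘ suc) (*-suc 2 n)) (snd-pair (p ∘ suc) (q ∘ suc) n)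

-- Entry j of a pair comes from an entry of index at most j in one component.
pair-local : ∀ {p p′ q q′} k → p ≗[ k ] p′ → q ≗[ k ] q′ → ⟨ p , q ⟩ ≗[ k ] ⟨ p′ , q′ ⟩
pair-local _ eqp eqq zero          j<k = eqp 0 j<k
pair-local _ eqp eqq (suc zero)    j<k = eqq 0 (<-trans z<s j<k)
pair-local (suc (suc k)) eqp eqq (suc (suc j)) (s<s (s<s j<k)) =
  pair-local (suc k) (λ i i<k → eqp (suc i) (s<s i<k)) (λ i i<k → eqq (suc i) (s<s i<k))
    j (m<n⇒m<1+n j<k)

-- Taking q′ = q shows that such a relation is single-valued: it is the graph of a partial
-- continuous map.
Continuous : (𝒦₂ → 𝒦₂ → Set) → Set
Continuous R = ∀ {q r} → R q r → ∀ n →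
  ∃[ k ] (∀ {q′ r′} → q ≗[ k ] q′ → R q′ r′ → r n ≡ r′ n)

pad : List ℕ → 𝒦₂
pad []      _       = 0
pad (x ∷ s) zero    = x
pad (x ∷ s) (suc n) = pad s n

pad-applyUpTo : ∀ q k → pad (applyUpTo q k) ≗[ k ] q
pad-applyUpTo q (suc k) zero    _         = refl
pad-applyUpTo q (suc k) (suc j) (s<s j<k) = pad-applyUpTo (q ∘ suc) k j j<k

-- The points of ℕ∞ (`nothing` being ∞), their bits and doubling

Point : Set
Point = Maybe ℕ

bit : Point → ℕ → Fin 2
bit nothing  i = zero
bit (just n) i with n ≟ i
... | yes _ = suc zero
... | no _  = zero

bit-just : ∀ {n i} → n ≡ i → bit (just n) i ≡ suc zero
bit-just {n} {i} n≡i with n ≟ i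
... | yes _  = refl
... | no n≢i = ⊥-elim (n≢i n≡i)

bit-just-≢ : ∀ {n i} → n ≢ i → bit (just n) i ≡ zero
bit-just-≢ {n} {i} n≢i with n ≟ i
... | yes n≡i = ⊥-elim (n≢i n≡i)
... | no _    = refl

bit≡1 : ∀ x {i} → bit x i ≡ suc zero → x ≡ just i
bit≡1 (just n) {i} eq with n ≟ i
bit≡1 (just n) eq | yes refl = refl
bit≡1 (just n) () | no _

bit-injective : ∀ x y → bit x ≗ bit y → x ≡ y
bit-injective nothing  nothing  eq = refl
bit-injective x        (just n) eq = bit≡1 x (trans (eq n) (bit-just refl))
bit-injective (just n) nothing  eq = sym (bit≡1 nothing (trans (sym (eq n)) (bit-just refl)))

bits : Point → 𝒦₂
bits x = toℕ ∘ bit x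

-- The numbers converge to ∞: the only 1 of n lies beyond this prefix.
bits-near-∞ : ∀ n → bits nothing ≗[ n ] bits (just n)
bits-near-∞ n j j<n = cong toℕ (sym (bit-just-≢ (>⇒≢ j<n)))

double : Point → Point
double = mapMaybe λ n → suc (2 * n)

double-injective : ∀ x y → double x ≡ double y → x ≡ y
double-injective nothing  nothing  _  = refl
double-injective (just m) (just n) eq =
  cong just (*-cancelˡ-≡ m n 2 (suc-injective (just-injective eq)))

parity : ∀ m → ∃[ k ] (m ≡ 2 * k ⊎ m ≡ suc (2 * k))
parity zero    = 0 , inj₁ refl
parity (suc m) with parity m
... | k , inj₁ eq = k , inj₂ (cong suc eq)
... | k , inj₂ eq = suc k , inj₁ (trans (cong suc eq) (sym (*-suc 2 k)))

bit-double-even : ∀ x k → bit (double x) (2 * k) ≡ zero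
bit-double-even nothing  k = refl
bit-double-even (just n) k = bit-just-≢ (even≢odd k n ∘ sym)

bit-double-odd : ∀ x k → bit (double x) (suc (2 * k)) ≡ bit x k
bit-double-odd nothing  k = refl
bit-double-odd (just n) k with n ≟ k
... | yes n≡k = bit-just (cong (λ m → suc (2 * m)) n≡k)
... | no n≢k  = bit-just-≢ (n≢k ∘ *-cancelˡ-≡ n k 2 ∘ suc-injective)

-- Interleaving with zeros moves a 1 from position n to 2n + 1, so on bits doubling is a mere
-- pairing.
bits-double : ∀ x → ⟨ const 0 , bits x ⟩ ≗ bits (double x)
bits-double x m with parity m
... | k , inj₁ refl = trans (fst-pair _ _ k) (cong toℕ (sym (bit-double-even x k)))
... | k , inj₂ refl = trans (snd-pair (const 0) (bits x) k) (cong toℕ (sym (bit-double-odd x k)))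

-- Sequences of the topos, the points they denote, and labellings

Nonempty : Truth ℓ → Set ℓ
Nonempty T = ∃[ p ] T ∋ p

Sequence : Set₁
Sequence = ℕ → Fin 2 → Ω

Denotes : Sequence → Point → Set
Denotes α x = ∀ i → Nonempty (α i (bit x i))

SingleValued : Sequence → Set
SingleValued α = ∀ {i b b′} → Nonempty (α i b) → Nonempty (α i b′) → b ≡ b′

denoted-bit : ∀ {α x i b} → SingleValued α → Denotes α x → Nonempty (α i b) → b ≡ bit x i
denoted-bit sv αx m = sv m (αx _)

denotes-unique : ∀ {α x y} → SingleValued α → Denotes α x → Denotes α y → x ≡ y
denotes-unique sv αx αy = bit-injective _ _ λ i → sv (αx i) (αy i)

-- Has b x i says that i is a label of the point x of the set A (if b is true)
-- or B (if b is false).  The laws make x ↦ double x a reduction both of A to B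
-- and of B to A, always by the same maps on labels.
record Labelling : Set₁ where
  field
    Has  : Bool → Point → ℕ → Set
    up   : ∀ {b} x i → Has b x i → Has (not b) (double x) (suc i)
    down : ∀ {b} x i → Has (not b) (double x) i → Has b x (pred i)

open Labelling

-- Here ∞ has labels, so realizers can be evaluated at ∞.
full : Labelling
full .Has _ _ _ = ⊤
full .up _ _ _ = tt
full .down _ _ _ = tt

walk : ℕ → ℕ → ℕ
walk n zero    = n
walk n (suc t) = suc (2 * walk n t)

turn : Bool → ℕ → Bool
turn b zero    = b
turn b (suc t) = not (turn b t)

-- Keeps the whole orbit of a large number in the range where limits at ∞ apply.
start≤walk : ∀ n t → n ≤ walk n t
start≤walk n zero    = ≤-refl
start≤walk n (suc t) = ≤-trans (start≤walk n t) (m≤n⇒m≤1+n (m≤m+n (walk n t) _))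

double≢even : ∀ x k → double x ≢ just (2 * k)
double≢even (just m) k eq = even≢odd k m (sym (just-injective eq))

walk≡start : ∀ k t → walk (2 * k) t ≡ 2 * k → t ≡ 0
walk≡start k zero    _  = refl
walk≡start k (suc t) eq = ⊥-elim (even≢odd k (walk (2 * k) t) (sym eq))

-- The least labelling in which the even number 2 * k has label c on side b.
orbit : Bool → ℕ → ℕ → Labelling
orbit b k c .Has b′ x i =
  ∃[ t ] (x ≡ just (walk (2 * k) t) × i ≡ t + c × b′ ≡ turn b t)
orbit b k c .up x i (t , x≡ , i≡ , b≡) = suc t , cong double x≡ , cong suc i≡ , cong not b≡
-- The start of the orbit is even, hence not in the image of `double`.
orbit b k c .down x i (zero , x≡ , _) = ⊥-elim (double≢even x k x≡)
orbit b k c .down x i (suc t , x≡ , i≡ , b≡) =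
  t , double-injective x (just (walk (2 * k) t)) x≡ , cong pred i≡ , not-injective b≡

-- Representing partial continuous maps in 𝒦₂

module _ (em : ExcludedMiddle (lsuc 0ℓ)) where

  private
    variable
      γ v v′ σ τ ι e₁ e₂ : 𝒦₂
      α β : Sequence
      x y : Point
      P : 𝒦₂ → Set ℓ₁
      Q : 𝒦₂ → Set ℓ₂

  decide : (P : Set) → Dec P
  decide P = map′ lower lift (em {Lift (lsuc 0ℓ) P})

  abstract
    decode : ℕ → List ℕ
    decode m with decide (∃[ l ] code l ≡ m)
    ... | yes (l , _) = l
    ... | no _        = []

    decode-code : ∀ l → decode (code l) ≡ l
    decode-code l with decide (∃[ l′ ] code l′ ≡ code l)
    ... | yes (l′ , eq) = code-injective l′ l eq
    ... | no ¬p         = ⊥-elim (¬p (l , refl))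

  module _ (R : 𝒦₂ → 𝒦₂ → Set) where
    -- The usual associate of a continuous map: `answer` replies as soon as the prefix s forces the
    -- entry at n.
    Forces : ℕ → List ℕ → ℕ → Set
    Forces n s v = ∀ {q r} → s ≡ applyUpTo q (length s) → R q r → r n ≡ v

    abstract
      answer : List ℕ → ℕ
      answer []      = 0
      answer (n ∷ s) with decide (∃[ v ] Forces n s v)
      ... | yes (v , _) = suc v
      ... | no _        = 0

      answer-sound : ∀ n s {v} → answer (n ∷ s) ≡ suc v → Forces n s v
      answer-sound n s eq with decide (∃[ v ] Forces n s v)
      answer-sound n s refl | yes (v , forces) = forces

      answer-complete : ∀ n s {v} → Forces n s v → ∃[ w ] answer (n ∷ s) ≡ suc w
      answer-complete n s forces with decide (∃[ v ] Forces n s v)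
      ... | yes (v , _) = v , refl
      ... | no ¬p       = ⊥-elim (¬p (_ , forces))

    rep : 𝒦₂
    rep m = answer (decode m)

    -- By continuity some prefix of q forces r n, so some prefix is answered. The first one answered
    -- is still a prefix of q, so the value it forces is r n.
    rep-↦ : Continuous R → R q r → rep · q ↦ r
    rep-↦ {q} {r} cont Rqr n =
      let k , mod = cont Rqr n
          v , eq = answer-complete n (applyUpTo q k) λ {q′} {r′} s≡ Rq′ →
            sym (mod (applyUpTo-injective k
                  (trans s≡ (cong (applyUpTo q′) (length-applyUpTo q k)))) Rq′)
          l , w , eqw , below = least-nonzero (λ j → rep (code (n ∷ applyUpTo q j))) k
            (trans (cong answer (decode-code (n ∷ applyUpTo q k))) eq)
          rn≡w = answer-sound n (applyUpTo q l)
            (trans (cong answer (sym (decode-code (n ∷ applyUpTo q l)))) eqw)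
            (cong (applyUpTo q) (sym (length-applyUpTo q l))) Rqr
      in l , trans eqw (cong suc (sym rn≡w)) , below

  up-to : ∀ {R} → Continuous R → R q r → ∀ n →
          ∃[ k ] (∀ {q′ r′} → q ≗[ k ] q′ → R q′ r′ → r ≗[ n ] r′)
  up-to cont Rqr zero = 0 , λ _ _ _ ()
  up-to {r = r} cont Rqr (suc n) =
    let k , below = up-to cont Rqr n ; l , at = cont Rqr n in
    k ⊔ l , λ {_} {r′} q≗q′ Rq′ j j<1+n → case m<1+n⇒m<n∨m≡n j<1+n of λ
      { (inj₁ j<n)  → below (≗[]-mono (m≤m⊔n k l) q≗q′) Rq′ j j<n
      ; (inj₂ refl) → at (≗[]-mono (m≤n⊔m k l) q≗q′) Rq′ }

  -- Being a record, it does not unfold to a statement about entries, so e, γ and r can be inferred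
  -- from it.
  record _at_↘_ (e γ r : 𝒦₂) : Set where
    constructor ev
    field run : e · γ ↦ r

  open _at_↘_ public

  ↘-continuous : ∀ {e} → Continuous (e at_↘_)
  ↘-continuous {e} {q} {r} x n =
    let k , same = app-continuous {e} {q} {r} (x .run) n in
    k , λ {q′} {r′} q≗q′ y → same {e} {q′} {r′} (λ _ _ → refl) q≗q′ (y .run)

  Paired Applied : 𝒦₂ → 𝒦₂ → 𝒦₂ → 𝒦₂ → Set
  Paired  e₁ e₂ q r = ∃[ s ] ∃[ t ] (e₁ at q ↘ s × e₂ at q ↘ t × ⟨ s , t ⟩ ≗ r)
  Applied e₁ e₂ q r = ∃[ s ] ∃[ t ] (e₁ at q ↘ s × e₂ at q ↘ t × s · t ↦ r)

  paired-continuous : ∀ {e₁ e₂} → Continuous (Paired e₁ e₂)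
  paired-continuous (s , t , s↦ , t↦ , eq) n =
    let k , sameˢ = up-to ↘-continuous s↦ (suc n)
        l , sameᵗ = up-to ↘-continuous t↦ (suc n)
    in k ⊔ l , λ { q≗q′ (s′ , t′ , s′↦ , t′↦ , eq′) →
         trans (sym (eq n)) (trans
           (pair-local (suc n) (sameˢ (≗[]-mono (m≤m⊔n k l) q≗q′) s′↦)
                               (sameᵗ (≗[]-mono (m≤n⊔m k l) q≗q′) t′↦) n (n<1+n n))
           (eq′ n)) }

  applied-continuous : ∀ {e₁ e₂} → Continuous (Applied e₁ e₂)
  applied-continuous {_} {_} {q} {r} (s , t , s↦ , t↦ , app) n =
    let m , same = app-continuous {s} {t} {r} app n
        k , sameˢ = up-to ↘-continuous s↦ m
        l , sameᵗ = up-to ↘-continuous t↦ m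
    in k ⊔ l , λ { {_} {r′} q≗q′ (s′ , t′ , s′↦ , t′↦ , app′) →
         same {s′} {t′} {r′} (sameˢ (≗[]-mono (m≤m⊔n k l) q≗q′) s′↦)
              (sameᵗ (≗[]-mono (m≤n⊔m k l) q≗q′) t′↦) app′ }

  -- Gathers the numbers computed from each n into one sequence; this turns a realizer of totality
  -- into a bit sequence.
  Collected : 𝒦₂ → 𝒦₂ → 𝒦₂ → Set
  Collected e q r = ∀ n → ∃[ s ] (e at ⟨ q , const n ⟩ ↘ s × s 0 ≡ r n)

  collected-continuous : ∀ {e} → Continuous (Collected e)
  collected-continuous all n =
    let s , s↦ , eq = all n ; k , same = ↘-continuous s↦ 0 in
    k , λ q≗q′ all′ → let s′ , s′↦ , eq′ = all′ n in
      trans (sym eq) (trans (same (pair-local k q≗q′ λ _ _ → refl) s′↦) eq′)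

  -- A prefix of q of some length determines a prefix of ⟨ γ , q ⟩ of the same
  -- length, so cur e γ can run e in step with the reading of q.
  curAt : 𝒦₂ → 𝒦₂ → List ℕ → ℕ
  curAt e γ []      = 0
  curAt e γ (n ∷ s) = e (code (n ∷ applyUpTo ⟨ γ , pad s ⟩ (length s)))

  abstract
    cur : 𝒦₂ → 𝒦₂ → 𝒦₂
    cur e γ m = curAt e γ (decode m)

    cur-continuous : ∀ e γ m → ∃[ k ] (∀ {γ′} → γ ≗[ k ] γ′ → cur e γ m ≡ cur e γ′ m)
    cur-continuous e γ m with decode m
    ... | []    = 0 , λ _ → refl
    ... | n ∷ s = length s , λ γ≗γ′ →
      cong (e ∘ code ∘ (n ∷_))
        (applyUpTo-cong (length s) (pair-local (length s) γ≗γ′ λ _ _ → refl))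

    cur-↦ : e at ⟨ γ , q ⟩ ↘ r → cur e γ · q ↦ r
    cur-↦ {e} {γ} {q} {r} app n =
      let k , halt , wait = app .run n in
      k , trans (same k) halt , λ j j<k → trans (same j) (wait j j<k)
      where
      same : ∀ k → cur e γ (code (n ∷ applyUpTo q k)) ≡ e (code (n ∷ applyUpTo ⟨ γ , q ⟩ k))
      same k = trans (cong (curAt e γ) (decode-code (n ∷ applyUpTo q k)))
        (trans (cong (λ l → e (code (n ∷ applyUpTo ⟨ γ , pad (applyUpTo q k) ⟩ l)))
                     (length-applyUpTo q k))
          (cong (e ∘ code ∘ (n ∷_))
            (applyUpTo-cong k (pair-local k (λ _ _ → refl) (pad-applyUpTo q k)))))

  -- Combinators for codes

  ContinuousMap : (𝒦₂ → 𝒦₂) → Set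
  ContinuousMap h = ∀ q n → ∃[ k ] (∀ {q′} → q ≗[ k ] q′ → h q n ≡ h q′ n)

  Graph : (𝒦₂ → 𝒦₂) → 𝒦₂ → 𝒦₂ → Set
  Graph h q r = h q ≗ r

  -- The suffix C marks codes of partial continuous maps.  They are used as terms
  -- over an environment, a nested pair whose last entry is accessed by topC.
  abstract
    mapC : (𝒦₂ → 𝒦₂) → 𝒦₂
    mapC h = rep (Graph h)

    pairC appC : 𝒦₂ → 𝒦₂ → 𝒦₂
    pairC e₁ e₂ = rep (Paired e₁ e₂)
    appC  e₁ e₂ = rep (Applied e₁ e₂)

    collectC : 𝒦₂ → 𝒦₂
    collectC e = rep (Collected e)

    ↘-map : ∀ {h} → ContinuousMap h → mapC h at γ ↘ h γ
    ↘-map {h = h} cont = ev (rep-↦ (Graph h)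
      (λ {q} eq n → let k , same = cont q n in
        k , λ q≗q′ eq′ → trans (sym (eq n)) (trans (same q≗q′) (eq′ n)))
      (λ _ → refl))

    ↘-pair : e₁ at γ ↘ r → e₂ at γ ↘ s → pairC e₁ e₂ at γ ↘ ⟨ r , s ⟩
    ↘-pair x y = ev (rep-↦ (Paired _ _) paired-continuous (_ , _ , x , y , λ _ → refl))

    ↘-app : e₁ at γ ↘ d → e₂ at γ ↘ q → d · q ↦ r → appC e₁ e₂ at γ ↘ r
    ↘-app {r = r} x y z = ev (rep-↦ (Applied _ _) {r = r} applied-continuous (_ , _ , x , y , z))

    ↘-collect : (∀ n → ∃[ s ] (e at ⟨ γ , const n ⟩ ↘ s × s 0 ≡ r n)) → collectC e at γ ↘ r
    ↘-collect all = ev (rep-↦ (Collected _) collected-continuous all)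

    idC : 𝒦₂
    idC = mapC id

    constC : 𝒦₂ → 𝒦₂
    constC c = mapC λ _ → c

    _∘C_ : 𝒦₂ → 𝒦₂ → 𝒦₂
    e ∘C d = appC (constC e) d

    ↘-id : idC at γ ↘ γ
    ↘-id = ↘-map λ q n → suc n , λ q≗q′ → q≗q′ n (n<1+n n)

    ↘-const : constC r at γ ↘ r
    ↘-const = ↘-map λ _ _ → 0 , λ _ → refl

    ↘-∘ : d at γ ↘ q → e at q ↘ r → (e ∘C d) at γ ↘ r
    ↘-∘ x y = ↘-app ↘-const x (y .run)

    lamC : 𝒦₂ → 𝒦₂
    lamC e = mapC (cur e)

    ↘-lam : lamC e at γ ↘ cur e γ
    ↘-lam {e} = ↘-map (cur-continuous e)

  ↘-resp : r ≗ s → e at γ ↘ r → e at γ ↘ s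
  ↘-resp {e = e} {γ} r≗s x = ev (↦-resp {e} {e} {γ} (λ _ → refl) (λ _ → refl) r≗s (x .run))

  fst-continuous : ContinuousMap fst
  fst-continuous q n = suc (2 * n) , λ q≗q′ → q≗q′ _ (n<1+n _)

  snd-continuous : ContinuousMap snd
  snd-continuous q n = suc (suc (2 * n)) , λ q≗q′ → q≗q′ _ (n<1+n _)

  fstC sndC wkC : 𝒦₂ → 𝒦₂
  fstC e = mapC fst ∘C e
  sndC e = mapC snd ∘C e
  wkC  e = e ∘C mapC fst

  topC : 𝒦₂
  topC = mapC snd

  ↘-fst : e at γ ↘ r → fstC e at γ ↘ fst r
  ↘-fst x = ↘-∘ x (↘-map fst-continuous)

  ↘-snd : e at γ ↘ r → sndC e at γ ↘ snd r
  ↘-snd x = ↘-∘ x (↘-map snd-continuous)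

  ↘-wk : e at γ ↘ r → wkC e at ⟨ γ , q ⟩ ↘ r
  ↘-wk x = ↘-∘ (↘-resp (fst-pair _ _) (↘-map fst-continuous)) x

  ↘-top : topC at ⟨ γ , q ⟩ ↘ q
  ↘-top = ↘-resp (snd-pair _ _) (↘-map snd-continuous)

  -- Realizability in an environment

  record _at_⊩_ (e γ : 𝒦₂) (P : 𝒦₂ → Set ℓ) : Set ℓ where
    constructor by
    field
      {value}   : 𝒦₂
      evaluates : e at γ ↘ value
      realizes  : P value

  open _at_⊩_ public

  ∧-intro : (S : Truth ℓ₁) (T : Truth ℓ₂) → S ∋ p → T ∋ q → (S ∧ T) ∋ ⟨ p , q ⟩
  ∧-intro S T m₁ m₂ =
    S .resp (λ n → sym (fst-pair _ _ n)) m₁ , T .resp (λ n → sym (snd-pair _ _ n)) m₂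

  ⊩-pair : (S : Truth ℓ₁) (T : Truth ℓ₂) → e₁ at γ ⊩ (S ∋_) → e₂ at γ ⊩ (T ∋_) →
           pairC e₁ e₂ at γ ⊩ ((S ∧ T) ∋_)
  ⊩-pair S T (by x₁ m₁) (by x₂ m₂) = by (↘-pair x₁ x₂) (∧-intro S T m₁ m₂)

  ⊩-app : e₁ at γ ↘ d → e₂ at γ ↘ q → Σ[ r ∈ 𝒦₂ ] (d · q ↦ r × P r) → appC e₁ e₂ at γ ⊩ P
  ⊩-app x y (r , app , m) = by (↘-app x y app) m

  ⊩-lam : P (cur e γ) → lamC e at γ ⊩ P
  ⊩-lam m = by ↘-lam m

  -- The introduction rule for implication, with membership in `_⇒_` unfolded.
  cur-realizes : (∀ q → P q → e at ⟨ γ , q ⟩ ⊩ Q) →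
                 ∀ q → P q → Σ[ r ∈ 𝒦₂ ] (cur e γ · q ↦ r × Q r)
  cur-realizes f q m = let by x m′ = f q m in _ , cur-↦ x , m′

  -- Equality and existence in ℕ∞

  single-valued : (α ≈[ 𝐍∞ ] β) ∋ d → SingleValued α
  single-valued {α} ((_ , _ , sv , _) , _) {i} {b} {b′} (p , m) (p′ , m′) =
    let _ , _ , b≡b′ , _ = sv i b b′ ⟨ p , p′ ⟩ (∧-intro (α i b) (α i b′) m m′) in b≡b′

  ≈-denotes : (α ≈[ 𝐍∞ ] β) ∋ d → Denotes α x → Denotes β x
  ≈-denotes ((_ , _ , _ , _ , iff) , _) αx i =
    let p , m = αx i ; r , _ , m′ = iff i _ .proj₁ p m in r , m′

  denotes-point : E 𝐍∞ α ∋ d → ∃[ x ] Denotes α x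
  denotes-point {α} ((_ , _ , _ , tot , _) , unique)
    with decide (∃[ n ] Nonempty (α n (suc zero)))
  ... | yes (n , p , m) = just n , den
    where
    den : Denotes α (just n)
    den i with tot i (const i) (refl , refl) | n ≟ i
    ... | _                     | yes refl = p , m
    ... | r , _ , zero , m′     | no _     = r , m′
    -- A second 1, at i, is identified with the one at n by the at-most-one clause.
    ... | r , _ , suc zero , m′ | no n≢i   =
      let _ , _ , u = unique n (const n) (refl , refl)
          _ , _ , u = u i (const i) (refl , refl)
          _ , _ , n≡i , _ = u ⟨ p , r ⟩ (∧-intro (α n (suc zero)) (α i (suc zero)) m m′)
      in ⊥-elim (n≢i n≡i)
  ... | no ¬1 = nothing , den
    where
    den : Denotes α nothing
    den i with tot i (const i) (refl , refl)
    ... | r , _ , zero , m     = r , m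
    ... | r , _ , suc zero , m = ⊥-elim (¬1 (i , r , m))

  Strict Total : Sequence → Truth 0ℓ
  Strict α = ⋀ λ i → ⋀ λ b → α i b ⇒ E 𝐍 i ∧ E 𝟐 b
  Total α  = ⋀ λ i → E 𝐍 i ⇒ ⋁ λ b → α i b

  Equivalent : Sequence → Sequence → Truth 0ℓ
  Equivalent α β = ⋀ λ i → ⋀ λ b → α i b ⇔ β i b

  AtMostOneOne : Sequence → Truth 0ℓ
  AtMostOneOne α = ∀[ i ∈ 𝐍 ] ∀[ j ∈ 𝐍 ] α i (suc zero) ∧ α j (suc zero) ⇒ i ≈[ 𝐍 ] j

  Extensional Unambiguous : Sequence → Truth 0ℓ
  Extensional α = ⋀ λ i → ⋀ λ j → ⋀ λ b → ⋀ λ c → α i b ∧ i ≈[ 𝐍 ] j ∧ b ≈[ 𝟐 ] c ⇒ α j c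
  Unambiguous α = ⋀ λ i → ⋀ λ b → ⋀ λ c → α i b ∧ α i c ⇒ b ≈[ 𝟐 ] c

  extC atMostOneOneC : 𝒦₂
  extC          = lamC (fstC topC)
  atMostOneOneC = lamC (lamC (lamC (wkC (wkC topC))))

  -- Realized equality in 𝐍 and 𝟐 is identity, so the realizer of α i b serves unchanged.
  ⊩-extensional : extC at γ ⊩ (Extensional α ∋_)
  ⊩-extensional = ⊩-lam λ i j b c → cur-realizes λ { q (m , (refl , _) , refl , _) →
    by (↘-fst ↘-top) m }

  -- A 1 at k makes x equal to `just k`, so i = j, and the realizer p of i realizes i ≈ j.
  ⊩-atMostOneOne : SingleValued α → Denotes α x → atMostOneOneC at γ ⊩ (AtMostOneOne α ∋_)
  ⊩-atMostOneOne {α} {x} sv αx =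
    ⊩-lam λ i → cur-realizes λ p (_ , p0≡i) →
    ⊩-lam λ j → cur-realizes λ q _ →
    ⊩-lam (cur-realizes λ r (mᵢ , mⱼ) →
    by (↘-wk (↘-wk ↘-top))
       (just-injective (trans (sym (point mᵢ)) (point mⱼ)) , p0≡i))
    where
    point : ∀ {k p} → α k (suc zero) ∋ p → x ≡ just k
    point m = bit≡1 x (sym (denoted-bit {α = α} {x = x} sv αx (_ , m)))

  singleC : 𝒦₂ → 𝒦₂
  singleC σ = lamC (sndC (appC (wkC σ) (fstC topC)))

  -- Since truth in 𝐍 and 𝟐 is decided by heads, strictness (σ), totality (τ) and
  -- the equivalence (ι) already determine the other parts of a realizer of α ≈ β.
  eqC : 𝒦₂ → 𝒦₂ → 𝒦₂ → 𝒦₂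
  eqC σ τ ι = pairC (pairC σ (pairC extC (pairC (singleC σ) (pairC τ ι)))) atMostOneOneC

  ⊩-eq : SingleValued α → Denotes α x →
         σ at γ ⊩ (Strict α ∋_) → τ at γ ⊩ (Total α ∋_) → ι at γ ⊩ (Equivalent α β ∋_) →
         eqC σ τ ι at γ ⊩ ((α ≈[ 𝐍∞ ] β) ∋_)
  ⊩-eq {α} {x} {σ} {γ} {τ} {ι} {β} sv αx s@(by evσ st) t u =
    ⊩-pair (α ≈[ 𝐍 ⟶ 𝟐 ] β) (AtMostOneOne α)
      (⊩-pair (Strict α) (Extensional α ∧ Unambiguous α ∧ Total α ∧ Equivalent α β) s
        (⊩-pair (Extensional α) (Unambiguous α ∧ Total α ∧ Equivalent α β) (⊩-extensional {α = α})
          (⊩-pair (Unambiguous α) (Total α ∧ Equivalent α β) single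
            (⊩-pair (Total α) (Equivalent α β) t u))))
      (⊩-atMostOneOne {α = α} {x = x} sv αx)
    where
    single : singleC σ at γ ⊩ (Unambiguous α ∋_)
    single = ⊩-lam λ i b c → cur-realizes λ q (m , m′) →
      let by r (_ , _ , q1≡b) = ⊩-app (↘-wk evσ) (↘-fst ↘-top) (st i b _ m)
      in by (↘-snd r) (sv (_ , m) (_ , m′) , q1≡b)

  iffReflC : 𝒦₂
  iffReflC = pairC (lamC topC) (lamC topC)

  ⊩-iff-refl : ∀ {a ℓ} {A : Set a} (φ : A → Truth ℓ) → iffReflC at γ ⊩ (λ p → ∀ x → (φ x ⇔ φ x) ∋ p)
  ⊩-iff-refl {γ} φ = by (↘-pair ↘-lam ↘-lam) λ x → ∧-intro (φ x ⇒ φ x) (φ x ⇒ φ x) refl⇒ refl⇒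
    where
    refl⇒ : ∀ {ℓ} {P : 𝒦₂ → Set ℓ} → ∀ q → P q → Σ[ r ∈ 𝒦₂ ] (cur topC γ · q ↦ r × P r)
    refl⇒ = cur-realizes λ q m → by ↘-top m

  strictC totalC iffC : 𝒦₂ → 𝒦₂
  strictC v = fstC (fstC v)
  totalC  v = fstC (sndC (sndC (sndC (fstC v))))
  iffC    v = sndC (sndC (sndC (sndC (fstC v))))

  ↘-strict : v at γ ↘ p → strictC v at γ ↘ _
  ↘-strict x = ↘-fst (↘-fst x)

  ↘-total : v at γ ↘ p → totalC v at γ ↘ _
  ↘-total x = ↘-fst (↘-snd (↘-snd (↘-snd (↘-fst x))))

  ↘-iff : v at γ ↘ p → iffC v at γ ↘ _
  ↘-iff x = ↘-snd (↘-snd (↘-snd (↘-snd (↘-fst x))))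

  rightC : 𝒦₂ → 𝒦₂
  rightC v = eqC
    (lamC (appC (wkC (strictC v)) (appC (wkC (sndC (iffC v))) topC)))
    (lamC (appC (wkC (fstC (iffC v))) (appC (wkC (totalC v)) topC)))
    iffReflC

  -- Strictness and totality of β are those of α, moved along the equivalence.
  ⊩-right : v at γ ↘ d → (α ≈[ 𝐍∞ ] β) ∋ d → Denotes β x → rightC v at γ ⊩ (E 𝐍∞ β ∋_)
  ⊩-right {v} {γ} {d} {α} {β} {x} vd α≈β@((st , _ , _ , tot , iff) , _) βx =
    ⊩-eq {α = β} {x = x} {β = β} sv βx
    (⊩-lam λ i b → cur-realizes λ q m →
      let by r m′ = ⊩-app (↘-wk (↘-snd (↘-iff vd))) ↘-top (iff i b .proj₂ q m)
      in ⊩-app (↘-wk (↘-strict vd)) r (st i b _ m′))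
    (⊩-lam λ i → cur-realizes λ q m →
      let by r (b , m′) = ⊩-app (↘-wk (↘-total vd)) ↘-top (tot i q m)
          by s m″ = ⊩-app (↘-wk (↘-fst (↘-iff vd))) r (iff i b .proj₁ _ m′)
      in by s (b , m″))
    (let by r m = ⊩-iff-refl (λ (i , b) → β i b) in by r λ i b → m (i , b))
    where
    sv : SingleValued β
    sv {i} {b} {b′} (_ , m) (_ , m′) =
      let p , _ , n = iff i b .proj₂ _ m ; p′ , _ , n′ = iff i b′ .proj₂ _ m′
      in single-valued {α} {β} {d} α≈β (p , n) (p′ , n′)

  translateC : 𝒦₂ → 𝒦₂ → 𝒦₂
  translateC v v′ = lamC (appC (wkC (totalC v′)) (fstC (appC (wkC (strictC v)) topC)))

  sameC : 𝒦₂ → 𝒦₂ → 𝒦₂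
  sameC v v′ = eqC (strictC v) (totalC v) (pairC (translateC v v′) (translateC v′ v))

  -- Strictness of α recovers i from a realizer of α i b. Totality of β then realizes β i b′ for
  -- some b′, and b′ = b since both are the bit of x at i.
  ⊩-translate : v at γ ↘ d → v′ at γ ↘ q → E 𝐍∞ α ∋ d → E 𝐍∞ β ∋ q → Denotes α x → Denotes β x →
                translateC v v′ at γ ⊩ (λ p → ∀ i b → (α i b ⇒ β i b) ∋ p)
  ⊩-translate {d = d} {q = q} {α = α} {β} {x} vd vq
    Eα@((st , _) , _) Eβ@((_ , _ , _ , tot , _) , _) αx βx =
    ⊩-lam λ i b → cur-realizes λ p m →
      let by r ((_ , r0≡i) , _) = ⊩-app (↘-wk (↘-strict vd)) ↘-top (st i b p m)
          by {w} s (b′ , m′) = ⊩-app (↘-wk (↘-total vq)) (↘-fst r) (tot i _ (refl , r0≡i))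
          b′≡b = trans (denoted-bit {β} {x} (single-valued {β} {β} {q} Eβ) βx (_ , m′))
                       (sym (denoted-bit {α} {x} (single-valued {α} {α} {d} Eα) αx (_ , m)))
      in by s (subst (λ b → β i b ∋ w) b′≡b m′)

  ⊩-same : v at γ ↘ d → v′ at γ ↘ q → E 𝐍∞ α ∋ d → E 𝐍∞ β ∋ q → Denotes α x → Denotes β x →
           sameC v v′ at γ ⊩ ((α ≈[ 𝐍∞ ] β) ∋_)
  ⊩-same {d = d} {q = q} {α = α} {β} {x} vd vq Eα@((st , _ , _ , tot , _) , _) Eβ αx βx =
    ⊩-eq {α = α} {x = x} {β = β} (single-valued {α} {α} {d} Eα) αx
      (by (↘-strict vd) st) (by (↘-total vd) tot)
      (let by r m   = ⊩-translate {α = α} {β} {x} vd vq Eα Eβ αx βx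
           by r′ m′ = ⊩-translate {α = β} {α} {x} vq vd Eβ Eα βx αx
       in by (↘-pair r r′) λ i b →
            ∧-intro (α i b ⇒ β i b) (β i b ⇒ α i b) (m i b) (m′ i b))

  -- Realizers carry only the index i, which makes totality trivial; the bits of x enter a realizer
  -- of existence through strictness.
  canonical : Point → Sequence
  canonical x i b ._∋_ p = p 0 ≡ i × b ≡ bit x i
  canonical x i b .resp p≗q (p0≡i , eq) = trans (sym (p≗q 0)) p0≡i , eq

  canonical-denotes : ∀ x → Denotes (canonical x) x
  canonical-denotes x i = const i , refl , refl

  canonical-single-valued : ∀ x → SingleValued (canonical x)
  canonical-single-valued x (_ , _ , refl) (_ , _ , eq) = sym eq

  lookupAt : 𝒦₂ → 𝒦₂
  lookupAt p = const (fst p (snd p 0))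

  lookupAt-continuous : ContinuousMap lookupAt
  -- Entry 1 of p holds the index, and the entry at twice that index holds the value.
  lookupAt-continuous p _ = 2 ⊔ suc (2 * p 1) , λ {q} p≗q →
    trans (p≗q _ (m≤n⊔m 2 (suc (2 * p 1))))
          (cong (q ∘ (2 *_)) (p≗q 1 (m≤m⊔n 2 (suc (2 * p 1)))))

  canonicalC : 𝒦₂ → 𝒦₂
  canonicalC v = eqC (lamC (pairC topC (mapC lookupAt ∘C pairC (wkC v) topC))) (lamC topC) iffReflC

  ⊩-canonical : v at γ ↘ bits x → canonicalC v at γ ⊩ (E 𝐍∞ (canonical x) ∋_)
  ⊩-canonical {x = x} vx = ⊩-eq {α = canonical x} {x = x} {β = canonical x}
    (canonical-single-valued x) (canonical-denotes x)
    (⊩-lam λ i b → cur-realizes λ { q (q0≡i , refl) →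
      ⊩-pair (E 𝐍 i) (E 𝟐 (bit x i)) (by ↘-top (refl , q0≡i))
        (by (↘-∘ (↘-pair (↘-wk vx) ↘-top) (↘-map lookupAt-continuous))
            (refl , trans (fst-pair (bits x) q _)
                          (cong (bits x) (trans (snd-pair (bits x) q 0) q0≡i)))) })
    (⊩-lam λ i → cur-realizes λ q (_ , q0≡i) → by ↘-top (bit x i , q0≡i , refl))
    (let by r m = ⊩-iff-refl (λ (i , b) → canonical x i b) in by r λ i b → m (i , b))

  readC : 𝒦₂ → 𝒦₂
  readC v = collectC (sndC (appC (wkC (strictC v)) (appC (wkC (totalC v)) topC)))

  -- Totality at n realizes some bit and strictness extracts it as a number; by single-valuedness it
  -- is the bit of x.
  ↘-read : v at γ ↘ d → E 𝐍∞ α ∋ d → Denotes α x → readC v at γ ↘ bits x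
  ↘-read {d = d} {α = α} {x} vd Eα@((st , _ , _ , tot , _) , _) αx = ↘-collect λ n →
    let by r (b , m) = ⊩-app (↘-wk (↘-total vd)) ↘-top (tot n (const n) (refl , refl))
        by s (_ , _ , s1≡b) = ⊩-app (↘-wk (↘-strict vd)) r (st n b _ m)
        b≡ = denoted-bit {α} {x} (single-valued {α} {α} {d} Eα) αx (_ , m)
    in _ , ↘-snd s , trans s1≡b (cong toℕ b≡)

  doubleC : 𝒦₂ → 𝒦₂
  doubleC v = pairC (constC (const 0)) v

  ↘-double : v at γ ↘ bits x → doubleC v at γ ↘ bits (double x)
  ↘-double {x = x} vx = ↘-resp (bits-double x) (↘-pair ↘-const vx)

  -- Labelled subsets and the doubling map

  Labelled : (Point → ℕ → Set) → Sequence → Ω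
  Labelled L α ._∋_ p = ∃[ x ] (Denotes α x × L x (p 0))
  Labelled L α .resp p≗q (x , αx , l) = x , αx , subst (L x) (p≗q 0) l

  Subset : (Point → ℕ → Set) → Carrier (𝒫 𝐍∞)
  Subset L α = E 𝐍∞ α ∧ Labelled L α

  subsetC : 𝒦₂
  subsetC = pairC (lamC (fstC topC))
    (pairC (lamC (pairC (rightC (sndC topC)) (sndC (fstC topC)))) iffReflC)

  -- Labels are merely copied, so one code serves every L.
  ⊩-subset : ∀ L → subsetC at γ ⊩ (E (𝒫 𝐍∞) (Subset L) ∋_)
  ⊩-subset L =
    ⊩-pair Str (Ext ∧ Iff)
      (⊩-lam λ α → cur-realizes λ q (m , _) → by (↘-fst ↘-top) m)
      (⊩-pair Ext Iff
        (⊩-lam λ α β → cur-realizes λ q ((_ , x , αx , l) , α≈β) →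
          ⊩-pair (E 𝐍∞ β) (Labelled L β)
            (⊩-right {α = α} {β} {x} (↘-snd ↘-top) α≈β (≈-denotes {α} {β} {snd q} {x} α≈β αx))
            (by (↘-snd (↘-fst ↘-top)) (x , ≈-denotes {α} {β} {snd q} {x} α≈β αx , l)))
        (⊩-iff-refl (Subset L)))
    where
    Str Ext Iff : Truth (lsuc 0ℓ)
    Str = ⋀ λ α → Subset L α ⇒ E 𝐍∞ α
    Ext = ⋀ λ α → ⋀ λ β → Subset L α ∧ α ≈[ 𝐍∞ ] β ⇒ Subset L β
    Iff = ⋀ λ α → Subset L α ⇔ Subset L α

  -- Free of computational content: any sequence realizes it once it is true, and `idC` fills the
  -- slot below.
  Doubled : Sequence → Sequence → Ω
  Doubled α β ._∋_ _ = ∃[ x ] (Denotes α x × Denotes β (double x))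
  Doubled α β .resp _ m = m

  Doubling : Carrier (𝐍∞ ⟶ 𝐍∞)
  Doubling α β = (E 𝐍∞ α ∧ E 𝐍∞ β) ∧ Doubled α β

  doublingC : 𝒦₂
  doublingC = pairC (lamC (fstC topC)) (pairC
    (lamC (pairC (pairC (rightC (fstC (sndC topC))) (rightC (sndC (sndC topC)))) idC)) (pairC
    (lamC (sameC (sndC (fstC (fstC topC))) (sndC (fstC (sndC topC))))) (pairC
    (lamC (pairC (pairC topC (canonicalC (doubleC (readC topC)))) idC))
    iffReflC)))

  ⊩-doubling : doublingC at γ ⊩ (E (𝐍∞ ⟶ 𝐍∞) Doubling ∋_)
  ⊩-doubling =
    ⊩-pair Str (Ext ∧ Sin ∧ Tot ∧ Iff)
      (⊩-lam λ α β → cur-realizes λ q (m , _) → by (↘-fst ↘-top) m)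
      (⊩-pair Ext (Sin ∧ Tot ∧ Iff)
        (⊩-lam λ α α′ β β′ → cur-realizes λ q ((_ , x , αx , βx) , α≈ , β≈) →
          let α′x = ≈-denotes {α} {α′} {fst (snd q)} {x} α≈ αx
              β′x = ≈-denotes {β} {β′} {snd (snd q)} {double x} β≈ βx in
          ⊩-pair (E 𝐍∞ α′ ∧ E 𝐍∞ β′) (Doubled α′ β′)
            (⊩-pair (E 𝐍∞ α′) (E 𝐍∞ β′)
              (⊩-right {α = α} {α′} {x} (↘-fst (↘-snd ↘-top)) α≈ α′x)
              (⊩-right {α = β} {β′} {double x} (↘-snd (↘-snd ↘-top)) β≈ β′x))
            (by ↘-id (x , α′x , β′x)))
        (⊩-pair Sin (Tot ∧ Iff)
          (⊩-lam λ α β β′ → cur-realizes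
            λ q (((Eα , Eβ) , x , αx , βx) , ((_ , Eβ′) , x′ , αx′ , β′x′)) →
            ⊩-same {α = β} {β′} {double x}
              (↘-snd (↘-fst (↘-fst ↘-top))) (↘-snd (↘-fst (↘-snd ↘-top))) Eβ Eβ′ βx
              (subst (Denotes β′ ∘ double)
                (denotes-unique {α} {x′} {x}
                  (single-valued {α} {α} {fst (fst (fst q))} Eα) αx′ αx) β′x′))
          (⊩-pair Tot Iff
            -- For totality, the bits of α are read off, interleaved with zeros and made into a
            -- canonical sequence.
            (⊩-lam λ α → cur-realizes λ q Eα →
              let x , αx = denotes-point {α} {q} Eα
                  β      = canonical (double x)
                  by r m = ⊩-pair (E 𝐍∞ α ∧ E 𝐍∞ β) (Doubled α β)
                    (⊩-pair (E 𝐍∞ α) (E 𝐍∞ β) (by ↘-top Eα)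
                      (⊩-canonical {x = double x} (↘-double {x = x} (↘-read {α = α} {x} ↘-top Eα αx))))
                    (by ↘-id (x , αx , canonical-denotes (double x)))
              in by r (β , m))
            (let by r m = ⊩-iff-refl (λ (α , β) → Doubling α β) in by r λ α β → m (α , β)))))
    where
    Str Ext Sin Tot Iff : Truth (lsuc 0ℓ)
    Str = ⋀ λ α → ⋀ λ β → Doubling α β ⇒ E 𝐍∞ α ∧ E 𝐍∞ β
    Ext = ⋀ λ α → ⋀ λ α′ → ⋀ λ β → ⋀ λ β′ →
            Doubling α β ∧ α ≈[ 𝐍∞ ] α′ ∧ β ≈[ 𝐍∞ ] β′ ⇒ Doubling α′ β′
    Sin = ⋀ λ α → ⋀ λ β → ⋀ λ β′ → Doubling α β ∧ Doubling α β′ ⇒ β ≈[ 𝐍∞ ] β′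
    Tot = ⋀ λ α → E 𝐍∞ α ⇒ ⋁ λ β → Doubling α β
    Iff = ⋀ λ α → ⋀ λ β → Doubling α β ⇔ Doubling α β

  injectiveC : 𝒦₂
  injectiveC = lamC (lamC (lamC (lamC
    (sameC (fstC (fstC (fstC topC))) (fstC (fstC (sndC topC)))))))

  ⊩-injective : injectiveC at γ ⊩ (Injective 𝐍∞ Doubling ∋_)
  ⊩-injective =
    ⊩-lam λ α → cur-realizes λ _ _ →
    ⊩-lam λ α′ → cur-realizes λ _ _ →
    ⊩-lam λ β → cur-realizes λ _ _ →
    ⊩-lam (cur-realizes λ q (((Eα , Eβ) , x , αx , βx) , ((Eα′ , _) , x′ , α′x′ , βx′)) →
      ⊩-same {α = α} {α′} {x}
        (↘-fst (↘-fst (↘-fst ↘-top))) (↘-fst (↘-fst (↘-snd ↘-top))) Eα Eα′ αx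
        (subst (Denotes α′)
          (double-injective x′ x
            (denotes-unique {β} {double x′} {double x}
              (single-valued {β} {β} {snd (fst (fst q))} Eβ) βx′ βx))
          α′x′))

  mapHead : (ℕ → ℕ) → 𝒦₂ → 𝒦₂
  mapHead h p = const (h (p 0))

  mapHead-continuous : ∀ h → ContinuousMap (mapHead h)
  mapHead-continuous h p _ = 1 , λ p≗q → cong h (p≗q 0 z<s)

  relabelC : (ℕ → ℕ) → 𝒦₂ → 𝒦₂
  relabelC h e = mapC (mapHead h) ∘C e

  preimageC : 𝒦₂
  preimageC = lamC (pairC
    (lamC (pairC u (pairC (pairC (pairC (fstC topC) u) idC) (pairC u (relabelC suc (sndC topC))))))
    (lamC (pairC (fstC (fstC (fstC (sndC topC)))) (relabelC pred (sndC (sndC (sndC topC)))))))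
    where
    u : 𝒦₂
    u = canonicalC (doubleC (readC (fstC topC)))

  -- Labels pass through `suc` towards the image and through `pred` on the way back, so the code
  -- depends on neither L nor M.
  ⊩-preimage : ∀ (L M : Point → ℕ → Set) →
    (∀ x i → L x i → M (double x) (suc i)) → (∀ x i → M (double x) i → L x (pred i)) →
    preimageC at γ ⊩ (IsPreimage 𝐍∞ Doubling (Subset L) (Subset M) ∋_)
  ⊩-preimage L M up down =
    ⊩-lam λ α → cur-realizes λ _ _ → ⊩-pair (Subset L α ⇒ Image α) (Image α ⇒ Subset L α)
      (⊩-lam (cur-realizes λ q (Eα , x , αx , l) →
        let β   = canonical (double x)
            Eβ  = ⊩-canonical {x = double x}
                    (↘-double {x = x} (↘-read {α = α} {x} (↘-fst ↘-top) Eα αx))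
            by r m = ⊩-pair (E 𝐍∞ β) (Doubling α β ∧ Subset M β) Eβ
              (⊩-pair (Doubling α β) (Subset M β)
                (⊩-pair (E 𝐍∞ α ∧ E 𝐍∞ β) (Doubled α β)
                  (⊩-pair (E 𝐍∞ α) (E 𝐍∞ β) (by (↘-fst ↘-top) Eα) Eβ)
                  (by ↘-id (x , αx , canonical-denotes (double x))))
                (⊩-pair (E 𝐍∞ β) (Labelled M β) Eβ
                  (by (↘-∘ (↘-snd ↘-top) (↘-map (mapHead-continuous suc)))
                      (double x , canonical-denotes (double x) , up x _ l))))
        in by r (β , m)))
      (⊩-lam (cur-realizes λ q (β , Eβ , (((Eα , _) , x , αx , βx) , (_ , y , βy , l))) →
        ⊩-pair (E 𝐍∞ α) (Labelled L α)
          (by (↘-fst (↘-fst (↘-fst (↘-snd ↘-top)))) Eα)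
          (by (↘-∘ (↘-snd (↘-snd (↘-snd ↘-top))) (↘-map (mapHead-continuous pred)))
              (x , αx , down x _ (subst (λ y → M y _)
                (denotes-unique {β} {y} {double x} (single-valued {β} {β} {fst q} Eβ) βy βx) l)))))
    where
    Image : Sequence → Truth (lsuc 0ℓ)
    Image α = ∃[ β ∈ 𝐍∞ ] Doubling α β ∧ Subset M β

  -- Uniform realizers of the premise and of the conclusion

  A B : Labelling → Carrier (𝒫 𝐍∞)
  A L = Subset (L .Has true)
  B L = Subset (L .Has false)

  Reduction Conclusion : Labelling → Truth (lsuc 0ℓ)
  Reduction L =
    ∃[ f ∈ 𝐍∞ ⟶ 𝐍∞ ] ∃[ g ∈ 𝐍∞ ⟶ 𝐍∞ ]
      Injective 𝐍∞ f ∧ Injective 𝐍∞ g ∧ IsPreimage 𝐍∞ f (A L) (B L) ∧ IsPreimage 𝐍∞ g (B L) (A L)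
  Conclusion L =
    ∃[ h ∈ 𝐍∞ ⟶ 𝐍∞ ] Bijective 𝐍∞ h ∧ RestrictsToBijection 𝐍∞ h (A L) (B L)

  reductionC : 𝒦₂
  reductionC = pairC doublingC (pairC doublingC
    (pairC injectiveC (pairC injectiveC (pairC preimageC preimageC))))

  ⊩-reduction : ∀ L → reductionC at γ ⊩ (Reduction L ∋_)
  ⊩-reduction L =
    let by r m = ⊩-pair Fun (Inj ∧ Inj ∧ Pre ∧ Pre′ Doubling) ⊩-doubling
          (⊩-pair Inj (Inj ∧ Pre ∧ Pre′ Doubling) ⊩-injective
            (⊩-pair Inj (Pre ∧ Pre′ Doubling) ⊩-injective
              (⊩-pair Pre (Pre′ Doubling)
                (⊩-preimage (L .Has true) (L .Has false) (L .up) (L .down))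
                (⊩-preimage (L .Has false) (L .Has true) (L .up) (L .down)))))
        by r m = ⊩-pair Fun
          (∃[ g ∈ 𝐍∞ ⟶ 𝐍∞ ] Inj ∧ Injective 𝐍∞ g ∧ Pre ∧ Pre′ g)
          ⊩-doubling (by r (Doubling , m))
    in by r (Doubling , m)
    where
    Fun Inj Pre : Truth (lsuc 0ℓ)
    Fun = E (𝐍∞ ⟶ 𝐍∞) Doubling
    Inj = Injective 𝐍∞ Doubling
    Pre = IsPreimage 𝐍∞ Doubling (A L) (B L)

    Pre′ : Carrier (𝐍∞ ⟶ 𝐍∞) → Truth (lsuc 0ℓ)
    Pre′ g = IsPreimage 𝐍∞ g (B L) (A L)

  -- The realizers fed to e do not depend on L, hence neither does its answer.
  conclusion : MyhillProperty 𝐍∞ ∋ e → Σ[ w ∈ 𝒦₂ ] (∀ L → Conclusion L ∋ w)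
  conclusion {e} myhill = result full .value , λ L →
    Conclusion L .resp
      (↦-deterministic {resultC} {const 0} {result L .value} {result full .value}
        (result L .evaluates .run) (result full .evaluates .run))
      (result L .realizes)
    where
    resultC : 𝒦₂
    resultC = appC (appC (appC (constC e) subsetC) subsetC) reductionC

    result : ∀ L → resultC at const 0 ⊩ (Conclusion L ∋_)
    result L =
      let by x m = ⊩-subset (L .Has true)
          by r m = ⊩-app ↘-const x (myhill (A L) _ m)
          by y n = ⊩-subset (L .Has false)
          by s m = ⊩-app r y (m (B L) _ n)
          by z o = ⊩-reduction L
      in ⊩-app s z (m _ o)

  -- Labels under h and its inverse, and the contradiction

  canonical-exists : ∀ x → Nonempty (E 𝐍∞ (canonical x))
  canonical-exists x = let m = ⊩-canonical {x = x} ↘-id in m .value , m .realizes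

  same-≈ : ∀ x → E 𝐍∞ α ∋ d → E 𝐍∞ β ∋ q → Denotes α x → Denotes β x → Nonempty (α ≈[ 𝐍∞ ] β)
  same-≈ {α} {d} {β} {q} x Eα Eβ αx βx =
    let m = ⊩-same {γ = ⟨ d , q ⟩} {α = α} {β} {x} (↘-wk ↘-id) ↘-top Eα Eβ αx βx
    in m .value , m .realizes

  module _ {w : 𝒦₂} (concl : ∀ L → Conclusion L ∋ w) where

    graph : Labelling → Carrier (𝐍∞ ⟶ 𝐍∞)
    graph L = concl L .proj₁

    -- Expresses h⁻¹(h(x)) = x. Extensionality replaces α by `canonical y`, since both denote y;
    -- injectivity then identifies `canonical x` with β.
    graph-injective : ∀ L {x y} →
      Nonempty (graph L (canonical x) α) → Nonempty (E 𝐍∞ α) → Denotes α y →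
      Nonempty (graph L β (canonical y)) → Nonempty (E 𝐍∞ β) → Denotes β x
    graph-injective {α} {β} L {x} {y} (p , hXα) (a , Eα) αy (p′ , hβY) (b , Eβ) =
      let _ , (_ , ext , _) , (inj , _) , _ = concl L
          X = canonical x ; Y = canonical y ; H = graph L
          c , EX = canonical-exists x
          d , EY = canonical-exists y
          q , α≈Y = same-≈ {α} {a} {Y} {d} y Eα EY αy (canonical-denotes y)
          r , _ , hXY = ext X X α Y ⟨ p , ⟨ c , q ⟩ ⟩
            (∧-intro (H X α) (X ≈[ 𝐍∞ ] X ∧ α ≈[ 𝐍∞ ] Y) hXα
              (∧-intro (X ≈[ 𝐍∞ ] X) (α ≈[ 𝐍∞ ] Y) EX α≈Y))
          _ , _ , injX   = inj X c EX
          _ , _ , injXβ  = injX β b Eβ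
          _ , _ , injXβY = injXβ Y d EY
          s , _ , X≈β = injXβY ⟨ r , p′ ⟩ (∧-intro (H X Y) (H β Y) hXY hβY)
      in ≈-denotes {X} {β} {s} {x} X≈β (canonical-denotes x)

    transportC : 𝒦₂ → 𝒦₂
    transportC f = appC (appC (constC f) u) (pairC u topC)
      where u = canonicalC (wkC idC)

    -- The continuous maps φ and ψ on labels, at an environment made of the bits of a point and a
    -- label. The projections extract the new label from the membership realizer in the answer.
    forwardC backwardC : 𝒦₂
    forwardC  = sndC (sndC (sndC (transportC (fst (snd (snd w))))))
    backwardC = sndC (fstC (sndC (transportC (snd (snd (snd w))))))

    ⊩-forward : ∀ L x {i} → L .Has true x i → forwardC at ⟨ bits x , const i ⟩ ⊩ λ r →
      ∃[ α ] ∃[ y ] (Nonempty (graph L (canonical x) α) × Nonempty (E 𝐍∞ α) × Denotes α y ×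
                     L .Has false y (r 0))
    ⊩-forward L x l =
      let _ , _ , _ , (r₁ , _) = concl L
          by u Ex = ⊩-canonical {x = x} (↘-wk ↘-id)
          by f m = ⊩-app ↘-const u (r₁ (canonical x) _ Ex)
          by a mA = ⊩-pair (E 𝐍∞ (canonical x)) (Labelled (L .Has true) (canonical x)) (by u Ex)
                      (by ↘-top (x , canonical-denotes x , l))
          by {v} r (α , Eα , hxα , _ , y , αy , l′) = ⊩-app f a (m _ mA)
      in by (↘-snd (↘-snd (↘-snd r))) (α , y , (fst (snd v) , hxα) , (fst v , Eα) , αy , l′)

    ⊩-backward : ∀ L y {i} → L .Has false y i → backwardC at ⟨ bits y , const i ⟩ ⊩ λ r →
      ∃[ α ] ∃[ x ] (Nonempty (graph L α (canonical y)) × Nonempty (E 𝐍∞ α) × Denotes α x ×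
                     L .Has true x (r 0))
    ⊩-backward L y l =
      let _ , _ , _ , (_ , r₂) = concl L
          by u Ey = ⊩-canonical {x = y} (↘-wk ↘-id)
          by f m = ⊩-app ↘-const u (r₂ (canonical y) _ Ey)
          by b mB = ⊩-pair (E 𝐍∞ (canonical y)) (Labelled (L .Has false) (canonical y)) (by u Ey)
                      (by ↘-top (y , canonical-denotes y , l))
          by {v} r (α , Eα , (_ , x , αx , l′) , hαy) = ⊩-app f b (m _ mB)
      in by (↘-snd (↘-fst (↘-snd r))) (α , x , (snd (snd v) , hαy) , (fst v , Eα) , αx , l′)

    -- The head of the value at ∞ depends on a finite prefix, which all large n share with ∞.
    limit : ∀ {c i} → c at ⟨ bits nothing , const i ⟩ ↘ r →
            ∃[ N ] (∀ {n s} → N ≤ n → c at ⟨ bits (just n) , const i ⟩ ↘ s → s 0 ≡ r 0)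
    limit x = let N , same = ↘-continuous x 0 in N , λ {n} N≤n y →
      sym (same (pair-local N (≗[]-mono N≤n (bits-near-∞ n)) λ _ _ → refl) y)

    zero-label : ∀ {i j M N} →
      (∀ {n s} → M ≤ n → forwardC at ⟨ bits (just n) , const 0 ⟩ ↘ s → s 0 ≡ j) →
      (∀ {n s} → N ≤ n → backwardC at ⟨ bits (just n) , const j ⟩ ↘ s → s 0 ≡ i) → i ≡ 0
    zero-label {i} {j} {M} {N} forward-limit backward-limit =
      -- This puts the even start 2k, and with it its whole orbit, above both thresholds.
      let k = M + N
          n = 2 * k
          L = orbit true k 0
          by run (α , _ , hα , Eα , αy , t , y≡ , s≡ , b≡) =
            ⊩-forward L (just n) (0 , refl , refl , refl)
          s≡j = forward-limit (≤-trans (m≤m+n M N) (m≤m+n k _)) run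
          y = just (walk n t)
          -- The point h(n) has label t + 0, which equals j, so ψ may be applied to it with label j.
          by run′ (β , x , hβ , Eβ , βx , t′ , x≡ , s′≡ , _) =
            ⊩-backward L y (t , refl , trans (sym s≡j) s≡ , b≡)
          s′≡i = backward-limit (≤-trans (≤-trans (m≤n+m N M) (m≤m+n k _)) (start≤walk n t)) run′
          -- As h⁻¹(h(n)) = n is the start of the orbit, t′ = 0, and the label i = t′ + 0 vanishes.
          βn = graph-injective {α} {β} L {just n} {y} hα Eα (subst (Denotes α) y≡ αy) hβ Eβ
          x≡n = denotes-unique {β} {x} {just n}
            (single-valued {β} {β} {Eβ .proj₁} (Eβ .proj₂)) βx βn
          t′≡0 = walk≡start k t′ (just-injective (trans (sym x≡) x≡n))
      in trans (sym s′≡i) (trans s′≡ (cong (_+ 0) t′≡0))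

    positive-label : ∀ {i j N} →
      (∀ {n s} → N ≤ n → backwardC at ⟨ bits (just n) , const j ⟩ ↘ s → s 0 ≡ i) → i ≢ 0
    positive-label {i} {j} {N} backward-limit i≡0 =
      let by run (_ , _ , _ , _ , _ , t , _ , s≡ , b≡) =
            ⊩-backward (orbit false N j) (just (2 * N)) (0 , refl , refl , refl)
          -- The label i is t + j. Were it 0, the point found in A would be the start of the orbit,
          -- which lies on side B.
          t≡0 = m+n≡0⇒m≡0 t (trans (sym s≡) (trans (backward-limit (m≤m+n N _) run) i≡0))
      in true≢false (trans b≡ (cong (turn false) t≡0))
      where
      true≢false : true ≢ false
      true≢false ()

    absurd : ⊥
    absurd =
      -- At ∞, φ sends the label 0 to some j and ψ sends j to some i; the limits carry both values
      -- over to all large n.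
      let by run  _ = ⊩-forward full nothing {0} tt
          by run′ _ = ⊩-backward full nothing tt
          _ , forward-limit  = limit run
          _ , backward-limit = limit run′
      in positive-label backward-limit (zero-label forward-limit backward-limit)

corollary23 : ExcludedMiddle (lsuc 0ℓ) → ¬ Valid (MyhillProperty 𝐍∞)
corollary23 em (e , _ , myhill) =
  let w , concl = conclusion em {e} myhill in absurd em {w} concl
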